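{- Let $\varphi$ be a propositional formula, $V=\mathrm{var}(\varphi)$, and $I\subseteq V$. Then $\langle I,I\rangle$ is an equilibrium model of $\varphi$ if and only if $I\cup I'$ is a model of $$(V=V')\wedge\mathrm{CIRC}(\tau[\varphi];V).$$
   Context: Formulas are built from atoms, the constants $\top,\bot$, and the primitive connectives $\neg,\wedge,\vee,\supset$; $\mathrm{var}(\varphi)$ is the set of variables of $\varphi$. A classical interpretation is a set $I$ of atoms ($p$ true iff $p\in I$). Priming: for each atom $p$, $p'$ is a globally new atom; $\varphi'$ replaces every atom $p$ of $\varphi$ by $p'$; for a set $I$ of atoms, $I'=\{p'\mid p\in I\}$. QBFs extend propositional formulas by quantifiers over atoms: under $I$, $\forall p\,\Psi$ is true iff both $\Psi[p/\top]$ and $\Psi[p/\bot]$ are true, $\exists p\,\Psi$ iff at least one is. $I$ is a model of $\Phi$ if $\Phi$ is true under $I$. $\exists P\,\Phi$ for a finite set $P$ of atoms quantifies all atoms of $P$. For indexed sets $S=\{\varphi_i\}$, $T=\{\psi_i\}$ of $n$ formulas, $S\le T$ abbreviates $\bigwedge_i(\varphi_i\supset\psi_i)$, $S<T$ abbreviates $(S\le T)\wedge\neg(T\le S)$, and $S=T$ abbreviates $(S\le T)\wedge(T\le S)$; in $V=V'$ the atom $p$ is paired with $p'$. HT: an HT-interpretation is a pair $\langle I_H,I_T\rangle$ of sets of atoms with $I_H\subseteq I_T$; worlds $H\le T$ ($\le$ reflexive). In world $w$: $\top$ true, $\bot$ false; atom $p$ true iff $p\in I_w$; $\wedge,\vee$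 classical in $w$; $\neg\psi$ true iff $\psi$ is false in all $u\ge w$; $\varphi_1\supset\varphi_2$ true iff for all $u\ge w$, $\varphi_1$ is false in $u$ or $\varphi_2$ is true in $u$. It is an HT-model of $\varphi$ iff $\varphi$ is true in $H$. An equilibrium model of $\varphi$ is a pair $\langle I,I\rangle$ that is an HT-model of $\varphi$ such that for no $J\subset I$ is $\langle J,I\rangle$ an HT-model of $\varphi$. Circumscription: for a formula $T$ and a finite set $P=\{p_1,\dots,p_n\}$ of atoms to be minimised (all other atoms of $T$ fixed), $\mathrm{CIRC}(T;P)=T\wedge\neg\exists\tilde P\big((\tilde P<P)\wedge T[P/\tilde P]\big)$, where $\tilde P=\{\tilde p_1,\dots,\tilde p_n\}$ are new atoms and $T[P/\tilde P]$ replaces each $p_i$ by $\tilde p_i$ (atoms outside $P$, in particular primed atoms, are left unchanged). Translation $\tau$: $\tau[\varphi]=\varphi$ if $\varphi$ is an atom, $\top$ or $\bot$; $\tau[\varphi_1\circ\varphi_2]=\tau[\varphi_1]\circ\tau[\varphi_2]$ for $\circ\in\{\wedge,\vee\}$; $\tau[\neg\psi]=\neg\psi'$; $\tau[\varphi_1\supset\varphi_2]=(\tau[\varphi_1]\supset\tau[\varphi_2])\wedge(\varphi_1'\supset\varphi_2')$. -}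

module Defs where

open import Data.Bool.Base using (Bool; true; false; if_then_else_) renaming (_∨_ to _or_; T to True)
open import Data.Empty using () renaming (⊥ to Empty)
open import Data.List.Base using (List; []; [_]; _++_; deduplicate)
open import Data.Nat.Base using (ℕ; suc; _+_)
open import Data.Product.Base using (_×_; _,_; proj₁)
open import Data.Sum.Base using (_⊎_)
open import Data.Unit.Base using () renaming (⊤ to Unit)
open import Data.Vec.Base as Vec using (Vec; []; _∷_)
import Data.Vec.Membership.DecPropositional as VecMembership
open import Function.Base using (_∘_)
open import Level using (0ℓ)
open import Relation.Binary.PropositionalEquality.Core using (_≡_; refl)
open import Relation.Binary.PropositionalEquality.Properties using (isDecEquivalence)
open import Relation.Binary.TypeClasses using (IsDecEquivalence; _≟_)
open import Relation.Nullary.Decidable.Core using (Dec; yes; no; does; map′)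
open import Relation.Nullary.Negation.Core using () renaming (¬_ to Not)
open import Relation.Unary using (Pred; _⊆_; _⊂_)

infix  9 _′
infix  9 _~
infix  8 ¬_
infixr 7 _∧_
infixr 6 _∨_
infixr 5 _⊃_
infix  5 ∀[_]_ ∃[_]_
infix  4 _≤_ _<_ _≐_

DecEq : Set → Set
DecEq X = IsDecEquivalence {A = X} _≡_

variable
  A X Y : Set
  m n : ℕ

data Formula (X : Set) : Set where
  atom        : X → Formula X
  ⊤ ⊥         : Formula X
  ¬_          : Formula X → Formula X
  _∧_ _∨_ _⊃_ : Formula X → Formula X → Formula X

_⟪_⟫ : Formula X → (X → Formula Y) → Formula Y
atom p  ⟪ σ ⟫ = σ p
⊤       ⟪ σ ⟫ = ⊤
⊥       ⟪ σ ⟫ = ⊥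
(¬ φ)   ⟪ σ ⟫ = ¬ (φ ⟪ σ ⟫)
(φ ∧ ψ) ⟪ σ ⟫ = φ ⟪ σ ⟫ ∧ ψ ⟪ σ ⟫
(φ ∨ ψ) ⟪ σ ⟫ = φ ⟪ σ ⟫ ∨ ψ ⟪ σ ⟫
(φ ⊃ ψ) ⟪ σ ⟫ = φ ⟪ σ ⟫ ⊃ ψ ⟪ σ ⟫

rename : (X → Y) → Formula X → Formula Y
rename f φ = φ ⟪ atom ∘ f ⟫

occurrences : Formula X → List X
occurrences (atom p) = [ p ]
occurrences ⊤        = []
occurrences ⊥        = []
occurrences (¬ φ)    = occurrences φ
occurrences (φ ∧ ψ)  = occurrences φ ++ occurrences ψ
occurrences (φ ∨ ψ)  = occurrences φ ++ occurrences ψ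
occurrences (φ ⊃ ψ)  = occurrences φ ++ occurrences ψ

var : ⦃ DecEq X ⦄ → Formula X → List X
var φ = deduplicate _≟_ (occurrences φ)

⋀ : Vec (Formula X) n → Formula X
⋀ []       = ⊤
⋀ (φ ∷ φs) = φ ∧ ⋀ φs

_≤_ _<_ _≐_ : Vec (Formula X) n → Vec (Formula X) n → Formula X
S ≤ T = ⋀ (Vec.zipWith _⊃_ S T)
S < T = (S ≤ T) ∧ ¬ (T ≤ S)
S ≐ T = (S ≤ T) ∧ (T ≤ S)

-- Sets of atoms are decidable, as every subset of the finite set of
-- variables of a formula is classically.
Interp : Set → Set
Interp X = X → Bool

⌊_⌋ : Interp X → Pred X 0ℓ
⌊ I ⌋ p = True (I p)

_∪_ : Interp X → Interp X → Interp X
(I ∪ J) p = I p or J p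

infix 3 _⊨ᶜ_

_⊨ᶜ_ : Interp X → Formula X → Set
I ⊨ᶜ atom p  = ⌊ I ⌋ p
I ⊨ᶜ ⊤       = Unit
I ⊨ᶜ ⊥       = Empty
I ⊨ᶜ (¬ φ)   = Not (I ⊨ᶜ φ)
I ⊨ᶜ (φ ∧ ψ) = (I ⊨ᶜ φ) × (I ⊨ᶜ ψ)
I ⊨ᶜ (φ ∨ ψ) = (I ⊨ᶜ φ) ⊎ (I ⊨ᶜ ψ)
I ⊨ᶜ (φ ⊃ ψ) = (I ⊨ᶜ φ) → (I ⊨ᶜ ψ)

-- The index bounds the nesting depth of quantifiers.  It does not
-- restrict which formulas exist; it makes the clauses
-- "∀p Ψ is true iff Ψ[p/⊤] and Ψ[p/⊥] are" a structural recursion.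
data QBF (X : Set) : ℕ → Set where
  prop        : Formula X → QBF X n
  ¬_          : QBF X n → QBF X n
  _∧_ _∨_ _⊃_ : QBF X n → QBF X n → QBF X n
  ∀[_]_ ∃[_]_ : X → QBF X n → QBF X (suc n)

constant : Bool → Formula X
constant true  = ⊤
constant false = ⊥

_[_≔_] : ⦃ DecEq X ⦄ → QBF X n → X → Bool → QBF X n
prop φ     [ p ≔ b ] = prop (φ ⟪ (λ q → if does (p ≟ q) then constant b else atom q) ⟫)
(¬ Φ)      [ p ≔ b ] = ¬ (Φ [ p ≔ b ])
(Φ ∧ Ψ)    [ p ≔ b ] = (Φ [ p ≔ b ]) ∧ (Ψ [ p ≔ b ])
(Φ ∨ Ψ)    [ p ≔ b ] = (Φ [ p ≔ b ]) ∨ (Ψ [ p ≔ b ])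
(Φ ⊃ Ψ)    [ p ≔ b ] = (Φ [ p ≔ b ]) ⊃ (Ψ [ p ≔ b ])
(∀[ q ] Ψ) [ p ≔ b ] = ∀[ q ] (if does (p ≟ q) then Ψ else Ψ [ p ≔ b ])
(∃[ q ] Ψ) [ p ≔ b ] = ∃[ q ] (if does (p ≟ q) then Ψ else Ψ [ p ≔ b ])

infix 3 _⊨_

_⊨_ : ⦃ DecEq X ⦄ → Interp X → QBF X n → Set
I ⊨ prop φ     = I ⊨ᶜ φ
I ⊨ (¬ Φ)      = Not (I ⊨ Φ)
I ⊨ (Φ ∧ Ψ)    = (I ⊨ Φ) × (I ⊨ Ψ)
I ⊨ (Φ ∨ Ψ)    = (I ⊨ Φ) ⊎ (I ⊨ Ψ)
I ⊨ (Φ ⊃ Ψ)    = (I ⊨ Φ) → (I ⊨ Ψ)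
I ⊨ (∀[ p ] Ψ) = (I ⊨ Ψ [ p ≔ true ]) × (I ⊨ Ψ [ p ≔ false ])
I ⊨ (∃[ p ] Ψ) = (I ⊨ Ψ [ p ≔ true ]) ⊎ (I ⊨ Ψ [ p ≔ false ])

∃* : Vec X m → QBF X n → QBF X (m + n)
∃* []      Φ = Φ
∃* (p ∷ P) Φ = ∃[ p ] (∃* P Φ)

-- The new atoms p̃ are adjoined to the atoms of the theory, so that they
-- cannot occur in it.
data Tilded (X : Set) : Set where
  old : X → Tilded X
  _~  : X → Tilded X

CIRC : ⦃ DecEq X ⦄ → Formula X → Vec X n → QBF (Tilded X) (n + 0)
CIRC {X = X} T P = prop (rename old T) ∧ ¬ ∃* (Vec.map _~ P) (prop ((P̃ < P°) ∧ T[P/P̃]))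
  where
  open VecMembership {A = X} _≟_ using (_∈?_)

  P̃ P° : Vec (Formula (Tilded X)) _
  P̃  = Vec.map (atom ∘ _~) P
  P° = Vec.map (atom ∘ old) P

  T[P/P̃] : Formula (Tilded X)
  T[P/P̃] = rename (λ p → if does (p ∈? P) then p ~ else old p) T

record HTInterp (X : Set) : Set where
  constructor ⟨_,_⟩[_]
  field
    I_H I_T : Interp X
    H⊆T     : ⌊ I_H ⌋ ⊆ ⌊ I_T ⌋

data World : Set where
  H T : World

data _≼_ : World → World → Set where
  ≼-refl : ∀ {w} → w ≼ w
  H≼T    : H ≼ T

at : HTInterp X → World → Interp X
at M H = HTInterp.I_H M
at M T = HTInterp.I_T M

infix 3 _,_⊩_ _⊨ᴴᵀ_

_,_⊩_ : HTInterp X → World → Formula X → Set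
M , w ⊩ atom p  = ⌊ at M w ⌋ p
M , w ⊩ ⊤       = Unit
M , w ⊩ ⊥       = Empty
M , w ⊩ (¬ ψ)   = ∀ u → w ≼ u → Not (M , u ⊩ ψ)
M , w ⊩ (φ ∧ ψ) = (M , w ⊩ φ) × (M , w ⊩ ψ)
M , w ⊩ (φ ∨ ψ) = (M , w ⊩ φ) ⊎ (M , w ⊩ ψ)
M , w ⊩ (φ ⊃ ψ) = ∀ u → w ≼ u → Not (M , u ⊩ φ) ⊎ (M , u ⊩ ψ)

_⊨ᴴᵀ_ : HTInterp X → Formula X → Set
M ⊨ᴴᵀ φ = M , H ⊩ φ

-- ⟨ I , I ⟩ is an equilibrium model of φ.
Equilibrium : Interp X → Formula X → Set
Equilibrium I φ =
  (⟨ I , I ⟩[ (λ p∈I → p∈I) ] ⊨ᴴᵀ φ) ×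
  (∀ J → (J⊂I : ⌊ J ⌋ ⊂ ⌊ I ⌋) → Not (⟨ J , I ⟩[ proj₁ J⊂I ] ⊨ᴴᵀ φ))

data Primed (A : Set) : Set where
  base : A → Primed A
  _′   : A → Primed A

prime : Formula A → Formula (Primed A)
prime = rename _′

τ : Formula A → Formula (Primed A)
τ (atom p)  = atom (base p)
τ ⊤         = ⊤
τ ⊥         = ⊥
τ (¬ ψ)     = ¬ prime ψ
τ (φ ∧ ψ)   = τ φ ∧ τ ψ
τ (φ ∨ ψ)   = τ φ ∨ τ ψ
τ (φ ⊃ ψ)   = (τ φ ⊃ τ ψ) ∧ (prime φ ⊃ prime ψ)

baseSet primeSet : Interp A → Interp (Primed A)
baseSet  I (base p) = I p
baseSet  I (p ′)    = false
primeSet I (base p) = false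
primeSet I (p ′)    = I p

oldSet : Interp X → Interp (Tilded X)
oldSet I (old p) = I p
oldSet I (p ~)   = false

instance
  Primed-decEq : ⦃ DecEq A ⦄ → DecEq (Primed A)
  Primed-decEq {A = A} = isDecEquivalence dec
    where
    dec : (p q : Primed A) → Dec (p ≡ q)
    dec (base p) (base q) = map′ (λ { refl → refl }) (λ { refl → refl }) (p ≟ q)
    dec (base p) (q ′)    = no λ ()
    dec (p ′)    (base q) = no λ ()
    dec (p ′)    (q ′)    = map′ (λ { refl → refl }) (λ { refl → refl }) (p ≟ q)

  Tilded-decEq : ⦃ DecEq X ⦄ → DecEq (Tilded X)
  Tilded-decEq {X = X} = isDecEquivalence dec
    where
    dec : (p q : Tilded X) → Dec (p ≡ q)
    dec (old p) (old q) = map′ (λ { refl → refl }) (λ { refl → refl }) (p ≟ q)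
    dec (old p) (q ~)   = no λ ()
    dec (p ~)   (old q) = no λ ()
    dec (p ~)   (q ~)   = map′ (λ { refl → refl }) (λ { refl → refl }) (p ≟ q)

{-# OPTIONS --safe #-}
module Submission where

-- The translation τ internalises the satisfaction relation of
-- here-and-there logic: an unprimed atom records truth at the world H and a
-- primed atom truth at the world T.  If L is the classical interpretation
-- that reads base p as p ∈ I_H and p ′ as p ∈ I_T, then L satisfies prime φ
-- iff φ holds at T (⊨ᶜ-prime), and L satisfies τ φ iff φ holds at H (⊨ᶜ-τ).
-- The second equivalence is an induction on φ; negation and implication use
-- that truth at H persists to T, and the case of implication also uses that
-- classical satisfaction is decidable.
--
-- On the other side, CIRC Θ P holds in I iff I is a model of Θ and no proper
-- subset of I that agrees with I outside P is a model of Θ (⊨-CIRC).  This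
-- needs the substitution semantics of the quantifiers to be turned into
-- updates of interpretations (⊨-≔), whence ∃ P Φ asks for an interpretation
-- that differs from the given one on P only (⊨-∃*).
--
-- Put the two together for Θ = τ φ and P = V.  The primed part of a proper
-- subset of I ∪ I′ that agrees with it outside V is still I′, and the
-- unprimed part is a set J ⊂ I; conversely J ⊂ I gives J ∪ I′, which differs
-- from I ∪ I′ on V only, because I ⊆ V.  So minimality of I ∪ I′ says that no
-- ⟨ J , I ⟩ with J ⊂ I is an HT-model of φ.  The conjunct V = V′ is true in
-- I ∪ I′ in any case.

open import Defs
open import Data.Bool.Base using (Bool; true; false; if_then_else_) renaming (T to True)
open import Data.Bool.Properties using (∨-identityʳ)
open import Data.Empty using (⊥-elim)
open import Data.List.Membership.Propositional using (_∈_)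
open import Data.Product.Base using (_×_; _,_; proj₁; ∃)
open import Data.Product.Function.NonDependent.Propositional using (_×-⇔_)
open import Data.Sum.Base using (inj₁; inj₂; [_,_]′)
open import Data.Sum.Function.Propositional using (_⊎-⇔_)
open import Data.Unit.Base using (tt)
open import Data.Vec.Base using (Vec; []; _∷_; fromList; map)
import Data.Vec.Membership.DecPropositional as VecMembership
open import Data.Vec.Membership.Propositional using () renaming (_∈_ to _∈ᵥ_; _∉_ to _∉ᵥ_)
open import Data.Vec.Membership.Propositional.Properties using (∈-map⁺; ∈-fromList⁺; fromAny)
open import Data.Vec.Relation.Unary.Any using (here; there)
open import Data.Vec.Relation.Unary.Any.Properties using (map⁻)
open import Function.Base using (_∘_; id)
open import Function.Bundles using (_⇔_; mk⇔; Equivalence)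
open import Function.Construct.Composition using (_⇔-∘_)
open import Function.Construct.Identity using (⇔-id)
open import Function.Construct.Symmetry using (⇔-sym)
open import Function.Related.TypeIsomorphisms using (→-cong-⇔; ¬-cong-⇔)
open import Relation.Binary.PropositionalEquality
  using (_≡_; _≗_; refl; sym; trans)
open import Relation.Binary.TypeClasses using (_≟_)
open import Relation.Nullary.Decidable
  using (Dec; yes; no; does; T?; ¬?; _×-dec_; _⊎-dec_; _→-dec_)
open import Relation.Nullary.Negation.Core using () renaming (¬_ to Not)
open import Relation.Unary using (_⊆_; _⊂_)

open Equivalence using (to; from)

-- Classical satisfaction

True-cong : {a b : Bool} → a ≡ b → True a ⇔ True b
True-cong refl = ⇔-id _

⊨ᶜ-dec : (I : Interp X) (φ : Formula X) → Dec (I ⊨ᶜ φ)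
⊨ᶜ-dec I (atom p) = T? (I p)
⊨ᶜ-dec I ⊤        = yes tt
⊨ᶜ-dec I ⊥        = no id
⊨ᶜ-dec I (¬ φ)    = ¬? (⊨ᶜ-dec I φ)
⊨ᶜ-dec I (φ ∧ ψ)  = ⊨ᶜ-dec I φ ×-dec ⊨ᶜ-dec I ψ
⊨ᶜ-dec I (φ ∨ ψ)  = ⊨ᶜ-dec I φ ⊎-dec ⊨ᶜ-dec I ψ
⊨ᶜ-dec I (φ ⊃ ψ)  = ⊨ᶜ-dec I φ →-dec ⊨ᶜ-dec I ψ

⊨ᶜ-⟪⟫ : (φ : Formula X) {σ : X → Formula Y} {I : Interp X} {J : Interp Y} →
        (∀ p → (J ⊨ᶜ σ p) ⇔ ⌊ I ⌋ p) → (J ⊨ᶜ φ ⟪ σ ⟫) ⇔ (I ⊨ᶜ φ)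
⊨ᶜ-⟪⟫ (atom p) e = e p
⊨ᶜ-⟪⟫ ⊤        e = ⇔-id _
⊨ᶜ-⟪⟫ ⊥        e = ⇔-id _
⊨ᶜ-⟪⟫ (¬ φ)    e = ¬-cong-⇔ (⊨ᶜ-⟪⟫ φ e)
⊨ᶜ-⟪⟫ (φ ∧ ψ)  e = ⊨ᶜ-⟪⟫ φ e ×-⇔ ⊨ᶜ-⟪⟫ ψ e
⊨ᶜ-⟪⟫ (φ ∨ ψ)  e = ⊨ᶜ-⟪⟫ φ e ⊎-⇔ ⊨ᶜ-⟪⟫ ψ e
⊨ᶜ-⟪⟫ (φ ⊃ ψ)  e = →-cong-⇔ (⊨ᶜ-⟪⟫ φ e) (⊨ᶜ-⟪⟫ ψ e)

⊨ᶜ-rename : (φ : Formula X) {f : X → Y} {I : Interp X} {J : Interp Y} →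
            J ∘ f ≗ I → (J ⊨ᶜ rename f φ) ⇔ (I ⊨ᶜ φ)
⊨ᶜ-rename φ e = ⊨ᶜ-⟪⟫ φ (True-cong ∘ e)

⊨ᶜ-cong : (φ : Formula X) {I J : Interp X} → I ≗ J → (I ⊨ᶜ φ) ⇔ (J ⊨ᶜ φ)
⊨ᶜ-cong φ e = ⊨ᶜ-rename φ {f = id} e ⇔-∘ ⇔-sym (⊨ᶜ-rename φ {f = id} (λ _ → refl))

⊨ᶜ-≤ : (f g : X → Formula Y) (P : Vec X n) {I : Interp Y} →
       (I ⊨ᶜ map f P ≤ map g P) ⇔ (∀ {p} → p ∈ᵥ P → I ⊨ᶜ f p → I ⊨ᶜ g p)
⊨ᶜ-≤ f g []      = mk⇔ (λ _ ()) (λ _ → tt)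
⊨ᶜ-≤ f g (p ∷ P) = mk⇔
  (λ { (i , _) (here refl) → i ; (_ , is) (there q∈P) → to (⊨ᶜ-≤ f g P) is q∈P })
  (λ i → i (here refl) , from (⊨ᶜ-≤ f g P) (λ q∈P → i (there q∈P)))

-- Quantified Boolean formulas

-- The interpretation that gives p the value b and agrees with I elsewhere.
_[_↦_] : ⦃ DecEq X ⦄ → Interp X → X → Bool → Interp X
(I [ p ↦ b ]) q = if does (p ≟ q) then b else I q

module _ ⦃ _ : DecEq X ⦄ where

  ⊨ᶜ-≔ : (φ : Formula X) {I : Interp X} {p : X} {b : Bool} →
         (I ⊨ prop {n = n} φ [ p ≔ b ]) ⇔ (I [ p ↦ b ] ⊨ᶜ φ)
  ⊨ᶜ-≔ φ {I} {p} {b} = ⊨ᶜ-⟪⟫ φ value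
    where
    ⊨ᶜ-constant : ∀ c → (I ⊨ᶜ constant c) ⇔ True c
    ⊨ᶜ-constant true  = ⇔-id _
    ⊨ᶜ-constant false = ⇔-id _

    value : ∀ q → (I ⊨ᶜ (if does (p ≟ q) then constant b else atom q)) ⇔
                  ⌊ I [ p ↦ b ] ⌋ q
    value q with p ≟ q
    ... | yes _ = ⊨ᶜ-constant b
    ... | no  _ = ⇔-id _

  ↦-cong : {I J : Interp X} (p : X) (b : Bool) → I ≗ J → I [ p ↦ b ] ≗ J [ p ↦ b ]
  ↦-cong p b e q with p ≟ q
  ... | yes _ = refl
  ... | no  _ = e q

  ↦-overwrite : (I : Interp X) (p : X) (b c : Bool) →
                I [ p ↦ c ] ≗ I [ p ↦ b ] [ p ↦ c ]
  ↦-overwrite I p b c q with p ≟ q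
  ... | yes _ = refl
  ... | no  _ = refl

  ↦-commute : (I : Interp X) {p q : X} (b c : Bool) → Not (p ≡ q) →
              I [ q ↦ c ] [ p ↦ b ] ≗ I [ p ↦ b ] [ q ↦ c ]
  ↦-commute I {p} {q} b c p≢q r with p ≟ r | q ≟ r
  ... | yes refl | yes refl = ⊥-elim (p≢q refl)
  ... | yes _    | no  _    = refl
  ... | no  _    | yes _    = refl
  ... | no  _    | no  _    = refl

  -- The recursion in ⊨-cong and ⊨-≔ is lexicographic: on the quantifier depth
  -- first, then on the formula.
  ⊨-cong : (Φ : QBF X n) {I J : Interp X} → I ≗ J → (I ⊨ Φ) ⇔ (J ⊨ Φ)

  -- Substituting a truth value for p amounts to updating the interpretation
  -- at p.
  ⊨-≔ : (Φ : QBF X n) {I : Interp X} {p : X} {b : Bool} →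
        (I ⊨ Φ [ p ≔ b ]) ⇔ (I [ p ↦ b ] ⊨ Φ)

  ⊨-cong (prop φ)   e = ⊨ᶜ-cong φ e
  ⊨-cong (¬ Φ)      e = ¬-cong-⇔ (⊨-cong Φ e)
  ⊨-cong (Φ ∧ Ψ)    e = ⊨-cong Φ e ×-⇔ ⊨-cong Ψ e
  ⊨-cong (Φ ∨ Ψ)    e = ⊨-cong Φ e ⊎-⇔ ⊨-cong Ψ e
  ⊨-cong (Φ ⊃ Ψ)    e = →-cong-⇔ (⊨-cong Φ e) (⊨-cong Ψ e)
  ⊨-cong (∀[ p ] Ψ) e = ⊨-cong (Ψ [ p ≔ true ]) e ×-⇔ ⊨-cong (Ψ [ p ≔ false ]) e
  ⊨-cong (∃[ p ] Ψ) e = ⊨-cong (Ψ [ p ≔ true ]) e ⊎-⇔ ⊨-cong (Ψ [ p ≔ false ]) e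

  -- Substitution under a quantifier that binds q: nothing happens if p is q,
  -- and the two substitutions commute otherwise.
  ⊨-≔-under : (Ψ : QBF X n) {I : Interp X} {p q : X} {b : Bool} (c : Bool) →
              (I ⊨ (if does (p ≟ q) then Ψ else Ψ [ p ≔ b ]) [ q ≔ c ]) ⇔
              (I [ p ↦ b ] ⊨ Ψ [ q ≔ c ])

  ⊨-≔ {n = n} (prop φ) = ⊨ᶜ-≔ {n = n} φ
  ⊨-≔ (¬ Φ)      = ¬-cong-⇔ (⊨-≔ Φ)
  ⊨-≔ (Φ ∧ Ψ)    = ⊨-≔ Φ ×-⇔ ⊨-≔ Ψ
  ⊨-≔ (Φ ∨ Ψ)    = ⊨-≔ Φ ⊎-⇔ ⊨-≔ Ψ
  ⊨-≔ (Φ ⊃ Ψ)    = →-cong-⇔ (⊨-≔ Φ) (⊨-≔ Ψ)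
  ⊨-≔ (∀[ q ] Ψ) = ⊨-≔-under Ψ true ×-⇔ ⊨-≔-under Ψ false
  ⊨-≔ (∃[ q ] Ψ) = ⊨-≔-under Ψ true ⊎-⇔ ⊨-≔-under Ψ false

  ⊨-≔-under Ψ {I} {p} {q} {b} c with p ≟ q
  ... | yes refl = ⇔-sym (⊨-≔ Ψ) ⇔-∘ (⊨-cong Ψ (↦-overwrite I p b c) ⇔-∘ ⊨-≔ Ψ)
  ... | no p≢q   = ⇔-sym (⊨-≔ Ψ) ⇔-∘ (⊨-cong Ψ (↦-commute I b c p≢q)
                   ⇔-∘ (⊨-≔ Ψ ⇔-∘ ⊨-≔ (Ψ [ p ≔ b ])))

-- J and I differ on P only.
_≗_off_ : Interp X → Interp X → Vec X n → Set
J ≗ I off P = ∀ {q} → q ∉ᵥ P → J q ≡ I q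

-- Repetitions in P are harmless: the substitution for an outer quantifier
-- stops at an inner quantifier of the same atom, and the inner one decides.
⊨-∃* : ⦃ _ : DecEq X ⦄ (P : Vec X m) (Φ : QBF X n) {I : Interp X} →
       (I ⊨ ∃* P Φ) ⇔ (∃ λ J → (J ≗ I off P) × (J ⊨ Φ))
⊨-∃* [] Φ {I} = mk⇔
  (λ I⊨Φ → I , (λ {_} _ → refl) , I⊨Φ)
  (λ (J , J≗I , J⊨Φ) → to (⊨-cong Φ (λ _ → J≗I λ ())) J⊨Φ)
⊨-∃* {X = X} (p ∷ P) Φ {I} = mk⇔
  (λ { (inj₁ h) → widen true h ; (inj₂ h) → widen false h })
  (λ (J , J≗I , J⊨Φ) →
    choose (J p) (from (⊨-≔ (∃* P Φ))
      (from (⊨-∃* P Φ) (J , narrow J J≗I , J⊨Φ))))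
  where
  widen : ∀ b → I ⊨ ∃* P Φ [ p ≔ b ] → ∃ λ J → (J ≗ I off (p ∷ P)) × (J ⊨ Φ)
  widen b h with to (⊨-∃* P Φ) (to (⊨-≔ (∃* P Φ)) h)
  ... | J , J≗I , J⊨Φ = J , (λ q∉ → trans (J≗I (q∉ ∘ there)) (kept q∉)) , J⊨Φ
    where
    kept : ∀ {q} → q ∉ᵥ (p ∷ P) → (I [ p ↦ b ]) q ≡ I q
    kept {q} q∉ with p ≟ q
    ... | yes refl = ⊥-elim (q∉ (here refl))
    ... | no  _    = refl

  narrow : ∀ J → J ≗ I off (p ∷ P) → J ≗ I [ p ↦ J p ] off P
  narrow J J≗I {q} q∉P with p ≟ q
  ... | yes refl = refl
  ... | no p≢q   = J≗I λ { (here q≡p) → p≢q (sym q≡p) ; (there q∈P) → q∉P q∈P }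

  choose : ∀ b → I ⊨ ∃* P Φ [ p ≔ b ] → I ⊨ ∃[ p ] ∃* P Φ
  choose true  = inj₁
  choose false = inj₂

-- Circumscription

∈-map⁻ : {f : X → Y} {P : Vec X n} {y : Y} →
         y ∈ᵥ map f P → ∃ λ p → (p ∈ᵥ P) × (y ≡ f p)
∈-map⁻ = fromAny ∘ map⁻

module _ ⦃ _ : DecEq X ⦄ (P : Vec X n) where
  open VecMembership {A = X} _≟_ using (_∈?_)

  -- The renaming [P/P̃].
  tilde : X → Tilded X
  tilde p = if does (p ∈? P) then p ~ else old p

  ∘tilde-∈ : (W : Interp (Tilded X)) {p : X} → p ∈ᵥ P → W (tilde p) ≡ W (p ~)
  ∘tilde-∈ W {p} p∈P with p ∈? P
  ... | yes _  = refl
  ... | no p∉P = ⊥-elim (p∉P p∈P)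

  ∘tilde-∉ : (W : Interp (Tilded X)) {p : X} → p ∉ᵥ P → W (tilde p) ≡ W (old p)
  ∘tilde-∉ W {p} p∉P with p ∈? P
  ... | yes p∈P = ⊥-elim (p∉P p∈P)
  ... | no  _   = refl

  -- The formula under the quantifiers of CIRC Θ P, in an interpretation that
  -- encodes I by the old atoms and J by the new ones (and by the old ones
  -- outside P).
  ⊨ᶜ-smaller-model :
    (Θ : Formula X) {W : Interp (Tilded X)} {I J : Interp X} →
    W ∘ old ≗ I → W ∘ tilde ≗ J →
    (W ⊨ᶜ (map (atom ∘ _~) P < map (atom ∘ old) P) ∧ rename tilde Θ) ⇔
    ((⌊ J ⌋ ⊂ ⌊ I ⌋) × (J ⊨ᶜ Θ))
  ⊨ᶜ-smaller-model Θ {W} {I} {J} W≗I W≗J = mk⇔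
      (λ (P̃≤P , P≰P̃) → J⊆I (to below P̃≤P) , λ I⊆J → P≰P̃ (from above (P≤P̃ I⊆J)))
      (λ (J⊆I , I⊈J) → from below (P̃≤P J⊆I) , λ P≤P̃ → I⊈J (I⊆J (to above P≤P̃)))
    ×-⇔ ⊨ᶜ-rename Θ W≗J
    where
    below = ⊨ᶜ-≤ (atom ∘ _~) (atom ∘ old) P
    above = ⊨ᶜ-≤ (atom ∘ old) (atom ∘ _~) P

    new : ∀ {p} → p ∈ᵥ P → ⌊ W ⌋ (p ~) ⇔ ⌊ J ⌋ p
    new p∈P = True-cong (trans (sym (∘tilde-∈ W p∈P)) (W≗J _))

    outside : ∀ {p} → p ∉ᵥ P → J p ≡ I p
    outside p∉P = trans (sym (W≗J _)) (trans (∘tilde-∉ W p∉P) (W≗I _))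

    J⊆I : (∀ {p} → p ∈ᵥ P → ⌊ W ⌋ (p ~) → ⌊ W ⌋ (old p)) → ⌊ J ⌋ ⊆ ⌊ I ⌋
    J⊆I P̃≤P {p} Jp with p ∈? P
    ... | yes p∈P = to (True-cong (W≗I p)) (P̃≤P p∈P (from (new p∈P) Jp))
    ... | no p∉P  = to (True-cong (outside p∉P)) Jp

    I⊆J : (∀ {p} → p ∈ᵥ P → ⌊ W ⌋ (old p) → ⌊ W ⌋ (p ~)) → ⌊ I ⌋ ⊆ ⌊ J ⌋
    I⊆J P≤P̃ {p} Ip with p ∈? P
    ... | yes p∈P = to (new p∈P) (P≤P̃ p∈P (from (True-cong (W≗I p)) Ip))
    ... | no p∉P  = from (True-cong (outside p∉P)) Ip

    P̃≤P : ⌊ J ⌋ ⊆ ⌊ I ⌋ → ∀ {p} → p ∈ᵥ P → ⌊ W ⌋ (p ~) → ⌊ W ⌋ (old p)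
    P̃≤P J⊆I p∈P = from (True-cong (W≗I _)) ∘ J⊆I ∘ to (new p∈P)

    P≤P̃ : ⌊ I ⌋ ⊆ ⌊ J ⌋ → ∀ {p} → p ∈ᵥ P → ⌊ W ⌋ (old p) → ⌊ W ⌋ (p ~)
    P≤P̃ I⊆J p∈P = from (new p∈P) ∘ I⊆J ∘ to (True-cong (W≗I _))

  -- The models of CIRC Θ P are the models of Θ that have no proper subset as a
  -- model among the interpretations agreeing with them outside P.
  ⊨-CIRC : (Θ : Formula X) {I : Interp X} →
    (oldSet I ⊨ CIRC Θ P) ⇔
    ((I ⊨ᶜ Θ) × Not (∃ λ J → (J ≗ I off P) × (⌊ J ⌋ ⊂ ⌊ I ⌋) × (J ⊨ᶜ Θ)))
  ⊨-CIRC Θ {I} =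
    ⊨ᶜ-rename Θ (λ _ → refl) ×-⇔
    ¬-cong-⇔ (mk⇔ decode encode ⇔-∘ ⊨-∃* P̃ (prop matrix))
    where
    P̃ = map _~ P

    matrix : Formula (Tilded X)
    matrix = (map (atom ∘ _~) P < map (atom ∘ old) P) ∧ rename tilde Θ

    decode : (∃ λ W → (W ≗ oldSet I off P̃) × (W ⊨ᶜ matrix)) →
             ∃ λ J → (J ≗ I off P) × (⌊ J ⌋ ⊂ ⌊ I ⌋) × (J ⊨ᶜ Θ)
    decode (W , W≗I , W⊨matrix) =
      W ∘ tilde ,
      (λ p∉P → trans (∘tilde-∉ W p∉P) (W-old _)) ,
      to (⊨ᶜ-smaller-model Θ W-old (λ _ → refl)) W⊨matrix
      where
      W-old : W ∘ old ≗ I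
      W-old p = W≗I (λ old∈P̃ → case-old (∈-map⁻ old∈P̃))
        where
        case-old : Not (∃ λ q → (q ∈ᵥ P) × (old p ≡ q ~))
        case-old (_ , _ , ())

    encode : (∃ λ J → (J ≗ I off P) × (⌊ J ⌋ ⊂ ⌊ I ⌋) × (J ⊨ᶜ Θ)) →
             ∃ λ W → (W ≗ oldSet I off P̃) × (W ⊨ᶜ matrix)
    encode (J , J≗I , J⊂I,J⊨Θ) =
      W , off , from (⊨ᶜ-smaller-model Θ (λ _ → refl) W-tilde) J⊂I,J⊨Θ
      where
      -- New atoms p ~ with p outside P are not quantified and stay false.
      W : Interp (Tilded X)
      W (old p) = I p
      W (p ~)   = if does (p ∈? P) then J p else false

      off : W ≗ oldSet I off P̃
      off {old p} _ = refl
      off {p ~}   p̃∉P̃ with p ∈? P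
      ... | yes p∈P = ⊥-elim (p̃∉P̃ (∈-map⁺ _~ p∈P))
      ... | no  _   = refl

      W-new : ∀ {p} → p ∈ᵥ P → W (p ~) ≡ J p
      W-new {p} p∈P with p ∈? P
      ... | yes _  = refl
      ... | no p∉P = ⊥-elim (p∉P p∈P)

      W-tilde : W ∘ tilde ≗ J
      W-tilde p = by-cases (p ∈? P)
        where
        by-cases : Dec (p ∈ᵥ P) → W (tilde p) ≡ J p
        by-cases (yes p∈P) = trans (∘tilde-∈ W p∈P) (W-new p∈P)
        by-cases (no  p∉P) = trans (∘tilde-∉ W p∉P) (sym (J≗I p∉P))

-- Here-and-there logic and the translation τ

⊩-persistent : {M : HTInterp X} (φ : Formula X) → M , H ⊩ φ → M , T ⊩ φ
⊩-persistent {M = M} (atom p) h        = HTInterp.H⊆T M h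
⊩-persistent ⊤                h        = tt
⊩-persistent (¬ φ)            h        = λ { T ≼-refl → h T H≼T }
⊩-persistent (φ ∧ ψ)          (h , k)  = ⊩-persistent φ h , ⊩-persistent ψ k
⊩-persistent (φ ∨ ψ)          (inj₁ h) = inj₁ (⊩-persistent φ h)
⊩-persistent (φ ∨ ψ)          (inj₂ h) = inj₂ (⊩-persistent ψ h)
⊩-persistent (φ ⊃ ψ)          h        = λ { T ≼-refl → h T H≼T }

-- At T, the last world, here-and-there satisfaction is classical.  The
-- decidability of ⊨ᶜ serves the implication, a disjunction of the falsity of
-- its premise and the truth of its conclusion.
⊩-T : {M : HTInterp X} (φ : Formula X) → (at M T ⊨ᶜ φ) ⇔ (M , T ⊩ φ)
⊩-T (atom p) = ⇔-id _
⊩-T ⊤        = ⇔-id _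
⊩-T ⊥        = ⇔-id _
⊩-T (¬ φ)    = mk⇔
  (λ { n T ≼-refl → n ∘ from (⊩-T φ) })
  (λ n → n T ≼-refl ∘ to (⊩-T φ))
⊩-T (φ ∧ ψ)  = ⊩-T φ ×-⇔ ⊩-T ψ
⊩-T (φ ∨ ψ)  = ⊩-T φ ⊎-⇔ ⊩-T ψ
⊩-T {M = M} (φ ⊃ ψ) = mk⇔
  (λ { f T ≼-refl → →⇒⊎ f (⊨ᶜ-dec (at M T) φ) })
  (λ h a → [ (λ n → ⊥-elim (n (to (⊩-T φ) a))) , from (⊩-T ψ) ]′ (h T ≼-refl))
  where
  →⇒⊎ : (at M T ⊨ᶜ φ → at M T ⊨ᶜ ψ) → Dec (at M T ⊨ᶜ φ) → _
  →⇒⊎ f (yes a) = inj₂ (to (⊩-T ψ) (f a))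
  →⇒⊎ f (no ¬a) = inj₁ (¬a ∘ from (⊩-T φ))

-- L encodes M: unprimed atoms describe the world H, primed atoms the world T.
module _ {M : HTInterp A} {L : Interp (Primed A)}
         (L-base : L ∘ base ≗ at M H) (L-prime : L ∘ _′ ≗ at M T) where

  ⊨ᶜ-prime : (φ : Formula A) → (L ⊨ᶜ prime φ) ⇔ (M , T ⊩ φ)
  ⊨ᶜ-prime φ = ⊩-T φ ⇔-∘ ⊨ᶜ-rename φ L-prime

  ⊨ᶜ-τ : (φ : Formula A) → (L ⊨ᶜ τ φ) ⇔ (M ⊨ᴴᵀ φ)
  ⊨ᶜ-τ (atom p) = True-cong (L-base p)
  ⊨ᶜ-τ ⊤        = ⇔-id _
  ⊨ᶜ-τ ⊥        = ⇔-id _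
  -- By persistence, φ is false at both worlds once it is false at T.
  ⊨ᶜ-τ (¬ φ)    = mk⇔
    (λ { n H ≼-refl → n ∘ from (⊨ᶜ-prime φ) ∘ ⊩-persistent φ
       ; n T H≼T    → n ∘ from (⊨ᶜ-prime φ) })
    (λ n → n T H≼T ∘ to (⊨ᶜ-prime φ))
  ⊨ᶜ-τ (φ ∧ ψ)  = ⊨ᶜ-τ φ ×-⇔ ⊨ᶜ-τ ψ
  ⊨ᶜ-τ (φ ∨ ψ)  = ⊨ᶜ-τ φ ⊎-⇔ ⊨ᶜ-τ ψ
  -- The conjunct prime φ ⊃ prime ψ is the truth of φ ⊃ ψ at T.
  ⊨ᶜ-τ (φ ⊃ ψ)  = mk⇔
    (λ { (f , g) H ≼-refl → →⇒⊎ f (⊨ᶜ-dec L (τ φ))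
       ; (f , g) T H≼T    → to (⊨ᶜ-prime (φ ⊃ ψ)) g T ≼-refl })
    (λ h → (λ a → [ (λ n → ⊥-elim (n (to (⊨ᶜ-τ φ) a))) , from (⊨ᶜ-τ ψ) ]′ (h H ≼-refl)) ,
           from (⊨ᶜ-prime (φ ⊃ ψ)) (⊩-persistent (φ ⊃ ψ) h))
    where
    →⇒⊎ : (L ⊨ᶜ τ φ → L ⊨ᶜ τ ψ) → Dec (L ⊨ᶜ τ φ) → _
    →⇒⊎ f (yes a) = inj₂ (to (⊨ᶜ-τ ψ) (f a))
    →⇒⊎ f (no ¬a) = inj₁ (¬a ∘ from (⊨ᶜ-τ φ))

-- Equilibrium models as minimal models of τ

∪-base : (J I : Interp A) → (baseSet J ∪ primeSet I) ∘ base ≗ J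
∪-base J I p = ∨-identityʳ (J p)

-- The set I ∪ I′ satisfies V = V′, whatever V is.
⊨ᶜ-V≐V′ : (I : Interp A) (V : Vec A n) →
          baseSet I ∪ primeSet I ⊨ᶜ map (atom ∘ base) V ≐ map (atom ∘ _′) V
⊨ᶜ-V≐V′ I V =
  from (⊨ᶜ-≤ (atom ∘ base) (atom ∘ _′) V) (λ {p} _ → to (True-cong (∪-base I I p))) ,
  from (⊨ᶜ-≤ (atom ∘ _′) (atom ∘ base) V) (λ {p} _ → from (True-cong (∪-base I I p)))

-- The right-hand side is the meaning of CIRC (τ φ) V in I ∪ I′.  The sets
-- J ⊂ I correspond to the proper subsets of I ∪ I′ agreeing with it outside V.
Equilibrium⇔minimal :
  (φ : Formula A) (I : Interp A) (V : Vec A n) → ⌊ I ⌋ ⊆ (_∈ᵥ V) →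
  let I∪I′ = baseSet I ∪ primeSet I in
  Equilibrium I φ ⇔
    ((I∪I′ ⊨ᶜ τ φ) ×
     Not (∃ λ N → (N ≗ I∪I′ off map base V) × (⌊ N ⌋ ⊂ ⌊ I∪I′ ⌋) × (N ⊨ᶜ τ φ)))
Equilibrium⇔minimal {A = A} φ I V I⊆V =
  ⇔-sym (⊨ᶜ-τ (∪-base I I) (λ _ → refl) φ) ×-⇔
  mk⇔ (λ min → λ { (N , off , N⊂ , N⊨τφ) → fromSmaller min N off N⊂ N⊨τφ })
      (λ min J J⊂I J⊨φ → min (toSmaller J J⊂I J⊨φ))
  where
  I∪I′ = baseSet I ∪ primeSet I

  base-I : ∀ {p} → ⌊ I∪I′ ⌋ (base p) ⇔ ⌊ I ⌋ p
  base-I {p} = True-cong (∪-base I I p)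

  fromSmaller :
    (∀ J → (J⊂I : ⌊ J ⌋ ⊂ ⌊ I ⌋) → Not (⟨ J , I ⟩[ proj₁ J⊂I ] ⊨ᴴᵀ φ)) →
    ∀ N → N ≗ I∪I′ off map base V → ⌊ N ⌋ ⊂ ⌊ I∪I′ ⌋ → Not (N ⊨ᶜ τ φ)
  fromSmaller min N off (N⊆ , ⊈N) N⊨τφ =
    min (N ∘ base) ((λ {p} → J⊆I {p}) , λ I⊆J → ⊈N (λ {q} → I∪I′⊆N I⊆J {q}))
        (to (⊨ᶜ-τ (λ _ → refl) N-prime φ) N⊨τφ)
    where
    prime∉ : ∀ {p} → p ′ ∉ᵥ map base V
    prime∉ p′∈ with ∈-map⁻ p′∈
    ... | _ , _ , ()

    N-prime : N ∘ _′ ≗ I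
    N-prime p = off prime∉

    J⊆I : ⌊ N ∘ base ⌋ ⊆ ⌊ I ⌋
    J⊆I = to base-I ∘ N⊆

    I∪I′⊆N : ⌊ I ⌋ ⊆ ⌊ N ∘ base ⌋ → ⌊ I∪I′ ⌋ ⊆ ⌊ N ⌋
    I∪I′⊆N I⊆J {base p} = I⊆J ∘ to base-I
    I∪I′⊆N I⊆J {p ′}    = from (True-cong (N-prime p))

  toSmaller :
    ∀ J → (J⊂I : ⌊ J ⌋ ⊂ ⌊ I ⌋) → ⟨ J , I ⟩[ proj₁ J⊂I ] ⊨ᴴᵀ φ →
    ∃ λ N → (N ≗ I∪I′ off map base V) × (⌊ N ⌋ ⊂ ⌊ I∪I′ ⌋) × (N ⊨ᶜ τ φ)
  toSmaller J (J⊆I , I⊈J) J⊨φ =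
    N , (λ {q} → off {q}) , ((λ {q} → N⊆ {q}) , ⊈N) ,
    from (⊨ᶜ-τ (∪-base J I) (λ _ → refl) φ) J⊨φ
    where
    N = baseSet J ∪ primeSet I

    base-J : ∀ {p} → ⌊ N ⌋ (base p) ⇔ ⌊ J ⌋ p
    base-J {p} = True-cong (∪-base J I p)

    N⊆ : ⌊ N ⌋ ⊆ ⌊ I∪I′ ⌋
    N⊆ {base p} = from base-I ∘ J⊆I ∘ to base-J
    N⊆ {p ′}    = id

    ⊈N : Not (⌊ I∪I′ ⌋ ⊆ ⌊ N ⌋)
    ⊈N ⊆N = I⊈J (λ {p} → to base-J ∘ ⊆N {base p} ∘ from base-I)

    both-false : {a b : Bool} → Not (True a) → Not (True b) → a ≡ b
    both-false {true}          ¬a _  = ⊥-elim (¬a tt)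
    both-false {false} {true}  _  ¬b = ⊥-elim (¬b tt)
    both-false {false} {false} _  _  = refl

    -- An atom outside V belongs to neither I nor J, since J ⊆ I ⊆ V.
    off : N ≗ I∪I′ off map base V
    off {base p} p∉ =
      both-false (p∉I ∘ J⊆I ∘ to base-J) (p∉I ∘ to base-I)
      where
      p∉I : Not (⌊ I ⌋ p)
      p∉I = p∉ ∘ ∈-map⁺ base ∘ I⊆V
    off {p ′}    _  = refl

theorem4 : {A : Set} ⦃ _ : DecEq A ⦄ (φ : Formula A) (I : Interp A) →
    let V = fromList (var φ) in
    ⌊ I ⌋ ⊆ (_∈ var φ) →
    Equilibrium I φ ⇔
    (oldSet (baseSet I ∪ primeSet I) ⊨
    prop (rename old (map (atom ∘ base) V ≐ map (atom ∘ _′) V))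
    ∧ CIRC (τ φ) (map base V))
theorem4 φ I I⊆V = mk⇔
  (λ eq → from (⊨ᶜ-rename V≐V′ (λ _ → refl)) (⊨ᶜ-V≐V′ I V) , to circ eq)
  (λ (_ , c) → from circ c)
  where
  V    = fromList (var φ)
  V≐V′ = map (atom ∘ base) V ≐ map (atom ∘ _′) V
  circ = ⇔-sym (⊨-CIRC (map base V) (τ φ)) ⇔-∘
         Equilibrium⇔minimal φ I V (∈-fromList⁺ ∘ I⊆V)
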